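{- Let $\mathcal{I}$ be an interval hypergraph on $[n]$ closed under intersection, and let $A,B$ be acyclic orientations of $\mathcal{I}$. The following are equivalent: (a) $A\le B$ in $P_{\mathcal{I}}$; (b) $A(I)\le B(I)$ for all $I\in\mathcal{I}$; (c) $\sigma_A\le\tau_B$ in the weak order; (d) for all $i<j$ in $[n]$, $j\prec_A i$ implies $i\not\prec_B j$.
   Context: An interval hypergraph $\mathcal{I}$ on $[n]$ is a collection of intervals of $[n]$ containing all singletons; it is closed under intersection if $I,J\in\mathcal{I}$, $I\cap J\ne\varnothing$ imply $I\cap J\in\mathcal{I}$. An orientation is a map $O:\mathcal{I}\to[n]$ with $O(I)\in I$; it is acyclic if there are no $H_1,\dots,H_k$, $k\ge2$, with $O(H_{i+1})\in H_i\setminus\{O(H_i)\}$ for $i\in[k-1]$ and $O(H_1)\in H_k\setminus\{O(H_k)\}$. Orientations $O\ne O'$ are related by an increasing flip (from $O$ to $O'$) if there exist $1\le i<j\le n$ such that for all $H$: if $O(H)\ne O'(H)$ then $O(H)=i$, $O'(H)=j$; and if $\{i,j\}\subseteq H$ then $O(H)=i\iff O'(H)=j$. $P_{\mathcal{I}}$ is the transitive closure of the increasing flip relation on acyclic orientations. For a permutation $\pi$, $\mathrm{Or}_\pi(I)=\pi(\min\{j:\pi(j)\in I\})$; for each acyclic orientation $A$ the fiber $\{\pi:\mathrm{Or}_\pi=A\}$ is an interval of the weak order, denoted $[\sigma_A,\tau_A]$. The partial order $\prec_A$ on $[n]$ is the transitive closure of $A(I)\prec_A h$ for $I\in\mathcal{I}$,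 $h\in I\setminus\{A(I)\}$. -}

module Defs where

open import Data.Bool using (Bool; T)
open import Data.Fin using (Fin; zero; suc; _≤_; _<_; inject₁; fromℕ)
open import Data.Fin.Permutation using (Permutation′; _⟨$⟩ʳ_; _⟨$⟩ˡ_; inverseʳ)
open import Data.Fin.Properties using (≤-refl)
open import Data.Fin.Subset using (Subset; _∈_; _∩_; ⁅_⁆; Nonempty)
open import Data.Fin.Subset.Properties using (_∈?_)
open import Data.Nat using (ℕ; suc; _+_; s<s)
open import Data.Product using (Σ; ∃; ∃₂; _×_; _,_; proj₁; proj₂)
open import Data.Sum using (_⊎_)
open import Function using (_∘_; _⇔_; Equivalence)
open import Relation.Binary.Construct.Closure.Transitive using (TransClosure)
open import Relation.Binary.PropositionalEquality using (_≡_; _≢_; sym; subst)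
open import Relation.Nullary using (¬_; yes; no)
open import Relation.Unary using (Pred; Decidable)

-- The ground set [n] is Fin n throughout, i.e. {0, …, n-1} with its usual order.

IsInterval : ∀ {n} → Subset n → Set
IsInterval {n} S = ∃₂ λ (a b : Fin n) → a ≤ b × (∀ x → x ∈ S ⇔ (a ≤ x × x ≤ b))

-- The collection is a Bool-valued characteristic function, so that being a
-- hyperedge is proof-irrelevant and a map out of Hyperedge really is a map
-- out of the collection.
record IntervalHypergraph (n : ℕ) : Set where
  field
    isEdge     : Subset n → Bool
    intervals  : ∀ S → T (isEdge S) → IsInterval S
    singletons : ∀ i → T (isEdge ⁅ i ⁆)

ClosedUnderIntersection : ∀ {n} → IntervalHypergraph n → Set
ClosedUnderIntersection 𝓘 =
  ∀ I J → T (isEdge I) → T (isEdge J) → Nonempty (I ∩ J) → T (isEdge (I ∩ J))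
  where open IntervalHypergraph 𝓘

Hyperedge : ∀ {n} → IntervalHypergraph n → Set
Hyperedge 𝓘 = ∃ λ S → T (IntervalHypergraph.isEdge 𝓘 S)

least : ∀ {n p} {P : Pred (Fin n) p} → Decidable P → ∃ P →
        ∃ λ j → P j × (∀ {k} → k < j → ¬ P k)
least {suc n} P? (x , px) with P? zero
... | yes p0 = zero , p0 , λ ()
least {suc n} P? (zero  , px) | no ¬p0 with () ← ¬p0 px
least {suc n} P? (suc x , px) | no ¬p0
  with j , pj , below ← least (P? ∘ suc) (x , px)
  = suc j , pj , λ { {zero} _ → ¬p0 ; {suc k} (s<s k<j) → below k<j }

module _ {n : ℕ} where

  -- σ is read as the word σ(1) … σ(n); an inversion is a pair of values
  -- i < j with j occurring to the left of i.
  Inversion : Permutation′ n → Fin n → Fin n → Set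
  Inversion σ i j = i < j × (σ ⟨$⟩ˡ j) < (σ ⟨$⟩ˡ i)

  infix 4 _≤ʷ_
  _≤ʷ_ : Permutation′ n → Permutation′ n → Set
  σ ≤ʷ τ = ∀ i j → Inversion σ i j → Inversion τ i j

module _ {n : ℕ} (𝓘 : IntervalHypergraph n) where
  open IntervalHypergraph 𝓘

  record Orientation : Set where
    field
      head   : Hyperedge 𝓘 → Fin n
      head∈  : ∀ H → head H ∈ proj₁ H

  open Orientation

  infix 4 _≈ᴼ_
  _≈ᴼ_ : Orientation → Orientation → Set
  O ≈ᴼ O′ = ∀ H → head O H ≡ head O′ H

  -- x ∈ H ∖ {O(H)}
  NonHead : Orientation → Fin n → Hyperedge 𝓘 → Set
  NonHead O x H = x ∈ proj₁ H × x ≢ head O H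

  -- A cycle of length k = m + 2.
  Cycle : Orientation → Set
  Cycle O = ∃ λ m → Σ (Fin (2 + m) → Hyperedge 𝓘) λ H →
    (∀ (i : Fin (suc m)) → NonHead O (head O (H (suc i))) (H (inject₁ i))) ×
    NonHead O (head O (H zero)) (H (fromℕ (suc m)))

  Acyclic : Orientation → Set
  Acyclic O = ¬ Cycle O

  AcyclicOrientation : Set
  AcyclicOrientation = Σ Orientation Acyclic

  IncreasingFlip : Orientation → Orientation → Set
  IncreasingFlip O O′ = ¬ (O ≈ᴼ O′) × (∃₂ λ i j → i < j × (∀ H →
    (head O H ≢ head O′ H → head O H ≡ i × head O′ H ≡ j) ×
    (i ∈ proj₁ H → j ∈ proj₁ H → (head O H ≡ i ⇔ head O′ H ≡ j))))

  -- The closure runs through acyclic orientations only.  Flips relate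
  -- distinct orientations, so the order relation also needs equality.
  infix 4 _≤ᴾ_
  _≤ᴾ_ : AcyclicOrientation → AcyclicOrientation → Set
  A ≤ᴾ B = proj₁ A ≈ᴼ proj₁ B ⊎
           TransClosure (λ (O O′ : AcyclicOrientation) → IncreasingFlip (proj₁ O) (proj₁ O′)) A B

  firstIn : (π : Permutation′ n) (H : Hyperedge 𝓘) →
            ∃ λ j → (π ⟨$⟩ʳ j) ∈ proj₁ H × (∀ {k} → k < j → ¬ (π ⟨$⟩ʳ k) ∈ proj₁ H)
  firstIn π (S , e) with a , b , a≤b , mem ← intervals S e =
    least (λ j → (π ⟨$⟩ʳ j) ∈? S)
          (π ⟨$⟩ˡ a , subst (_∈ S) (sym (inverseʳ π)) (Equivalence.from (mem a) (≤-refl , a≤b)))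

  Or : Permutation′ n → Orientation
  Or π .head  H = π ⟨$⟩ʳ proj₁ (firstIn π H)
  Or π .head∈ H = proj₁ (proj₂ (firstIn π H))

  -- The fibre { π : Or π = A } is the weak order interval [σ , τ].  By
  -- antisymmetry of the weak order this determines σ and τ as permutations.
  FibreIs[_,_] : Permutation′ n → Permutation′ n → Orientation → Set
  FibreIs[ σ , τ ] A = σ ≤ʷ τ × (∀ π → Or π ≈ᴼ A ⇔ (σ ≤ʷ π × π ≤ʷ τ))

  -- σ_A ≤ τ_B, with σ_A and τ_B introduced through their defining property.
  σ[_]≤τ[_] : Orientation → Orientation → Set
  σ[ A ]≤τ[ B ] = ∃₂ λ σA τA → ∃₂ λ σB τB →
    FibreIs[ σA , τA ] A × FibreIs[ σB , τB ] B × σA ≤ʷ τB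

  Precedes : Orientation → Fin n → Fin n → Set
  Precedes A = TransClosure (λ x h → ∃ λ I → head A I ≡ x × NonHead A h I)

{-# OPTIONS --safe #-}

-- Everything rests on one property of ≺_A: if x ≺_A z and y lies strictly between
-- x and z, then x ≺_A y, as the path from x to z visits or jumps over y.
-- It makes the relation "x ≺_A y, or x < y and not y ≺_A x" a linear order; this is
-- σ_A, whose inversions are the pairs i < j with j ≺_A i.  Dually the inversions of
-- τ_A are the pairs i < j with i ⊀_A j, so (c) and (d) say the same thing.  For
-- (c) ⇒ (a), sort σ_A into τ_B by adjacent exchanges: each of them changes Or_π by an
-- increasing flip or not at all.  For (b) ⇒ (d), a reversal j ≺_A i, i ≺_B j is
-- shrunk by comparing A and B on an intersection of two hyperedges.
module Submission where

open import Defs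
open import Data.Bool.Properties using (T?; T-irrelevant)
open import Data.Nat as ℕ using (ℕ; zero; suc; _*_; z<s; s<s)
import Data.Nat.Properties as ℕ
open import Data.Fin using (Fin; zero; suc; _≤_; _<_; toℕ; fromℕ<; fromℕ; inject₁; combine; remQuot; punchOut)
open import Data.Fin.Induction using (<-wellFounded)
open import Data.Fin.Permutation using (Permutation′; permutation; transpose; _∘ₚ_; _⟨$⟩ʳ_; _⟨$⟩ˡ_; inverseˡ; inverseʳ)
open import Data.Fin.Permutation.Components using () renaming (transpose to swap)
open import Data.Fin.Properties using (_≟_; _<?_; _≤?_; <-cmp; <-isStrictTotalOrder; any?; toℕ-injective; toℕ-inject₁; toℕ-fromℕ<; remQuot-combine; injective⇒≤; punchOut-injective; ≤-refl; ≤-total; ≤∧≢⇒<)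
open import Data.Fin.Subset using (Subset; _∈_; _∩_; ∣_∣; _⊂_)
open import Data.Fin.Subset.Induction using (⊃-wellFounded)
open import Data.Fin.Subset.Properties using (_∈?_; anySubset?; p⊂q⇒∣p∣<∣q∣; ∣⊤∣≡n; ∈⊤; x∈p∩q⁺; x∈p∩q⁻)
open import Data.List using (List; []; _∷_; allFin)
import Data.List.Membership.Propositional as List
open import Data.List.Membership.Propositional.Properties using (∈-allFin)
open import Data.List.Relation.Unary.Any using (here; there)
open import Data.Product using (∃; ∃₂; Σ; _×_; _,_; proj₁; proj₂)
open import Data.Sum using (_⊎_; inj₁; inj₂)
open import Data.Vec using (tabulate)
open import Data.Vec.Functional using () renaming (_∷_ to _◂_)
open import Data.Vec.Properties using (lookup⇒[]=; []=⇒lookup; lookup∘tabulate)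
open import Function using (_⇔_; mk⇔; Equivalence; _∘_; flip)
open import Induction.WellFounded using (Acc; acc)
open import Relation.Binary using (Rel; IsStrictTotalOrder; tri<; tri≈; tri>)
import Relation.Binary as Binary
import Relation.Binary.Construct.Flip.EqAndOrd as Flip
open import Relation.Binary.Construct.Closure.Transitive using (TransClosure; [_]; _∷_; _∷ʳ_; _++_)
open import Relation.Binary.PropositionalEquality using (_≡_; _≢_; refl; sym; trans; cong; subst; subst₂; isEquivalence)
open import Relation.Nullary using (¬_; Dec; yes; no; does; contradiction)
open import Relation.Nullary.Decidable using (dec-true; map′; _×-dec_; _⊎-dec_; ¬?; decidable-stable)
open import Relation.Unary using (Pred; Decidable)
open import Level using (0ℓ)

-- Decidable subsets and decidability of transitive closure.

subset : ∀ {n} {P : Pred (Fin n) 0ℓ} → Decidable P → Subset n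
subset P? = tabulate (λ x → does (P? x))

module _ {n : ℕ} {P : Pred (Fin n) 0ℓ} (P? : Decidable P) where

  ∈-subset⁺ : ∀ {x} → P x → x ∈ subset P?
  ∈-subset⁺ {x} px = lookup⇒[]= x _ (trans (lookup∘tabulate _ x) (dec-true (P? x) px))

  ∈-subset⁻ : ∀ {x} → x ∈ subset P? → P x
  ∈-subset⁻ {x} x∈ with P? x | trans (sym (lookup∘tabulate (λ y → does (P? y)) x)) ([]=⇒lookup x∈)
  ... | yes px | _ = px
  ... | no _   | ()

subset-⊂ : ∀ {n} {P Q : Pred (Fin n) 0ℓ} (P? : Decidable P) (Q? : Decidable Q) →
           (∀ {x} → P x → Q x) → ∀ {x} → Q x → ¬ P x → subset P? ⊂ subset Q?
subset-⊂ P? Q? P⇒Q {x} qx ¬px =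
  (λ y∈ → ∈-subset⁺ Q? (P⇒Q (∈-subset⁻ P? y∈))) , x , ∈-subset⁺ Q? qx , ¬px ∘ ∈-subset⁻ P?

-- Warshall's algorithm: vs lists the vertices allowed as intermediate ones.
module _ {n : ℕ} {R : Rel (Fin n) 0ℓ} (R? : Binary.Decidable R) where

  Via : List (Fin n) → Rel (Fin n) 0ℓ
  Via []       x y = R x y
  Via (v ∷ vs) x y = Via vs x y ⊎ (Via vs x v × Via vs v y)

  via? : ∀ vs → Binary.Decidable (Via vs)
  via? []       x y = R? x y
  via? (v ∷ vs) x y = via? vs x y ⊎-dec (via? vs x v ×-dec via? vs v y)

  via-step : ∀ vs {x y} → R x y → Via vs x y
  via-step []       r = r
  via-step (v ∷ vs) r = inj₁ (via-step vs r)

  via-sound : ∀ vs {x y} → Via vs x y → TransClosure R x y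
  via-sound []       r              = [ r ]
  via-sound (v ∷ vs) (inj₁ p)       = via-sound vs p
  via-sound (v ∷ vs) (inj₂ (p , q)) = via-sound vs p ++ via-sound vs q

  -- Whatever lies between two visits to the same listed vertex is cut out, so passing through each
  -- listed vertex at most once suffices.
  via-trans : ∀ vs {x y v} → v List.∈ vs → Via vs x v → Via vs v y → Via vs x y
  via-trans (v ∷ vs) (here refl) p q = inj₂ (left p , right q)
    where
    left : ∀ {x} → Via (v ∷ vs) x v → Via vs x v
    left (inj₁ r)       = r
    left (inj₂ (r , _)) = r
    right : ∀ {y} → Via (v ∷ vs) v y → Via vs v y
    right (inj₁ r)       = r
    right (inj₂ (_ , r)) = r
  via-trans (v ∷ vs) (there m) (inj₁ p)       (inj₁ q)       = inj₁ (via-trans vs m p q)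
  via-trans (v ∷ vs) (there m) (inj₁ p)       (inj₂ (q , s)) = inj₂ (via-trans vs m p q , s)
  via-trans (v ∷ vs) (there m) (inj₂ (p , r)) (inj₁ q)       = inj₂ (p , via-trans vs m r q)
  via-trans (v ∷ vs) (there m) (inj₂ (p , _)) (inj₂ (_ , s)) = inj₂ (p , s)

  via-complete : ∀ {x y} → TransClosure R x y → Via (allFin n) x y
  via-complete [ r ]   = via-step (allFin n) r
  via-complete (r ∷ p) = via-trans (allFin n) (∈-allFin _) (via-step (allFin n) r) (via-complete p)

  transClosure? : Binary.Decidable (TransClosure R)
  transClosure? x y = map′ (via-sound (allFin n)) via-complete (via? (allFin n) x y)

-- Finite strict total orders as permutations.

-- Pigeonhole: punching out a missed value would inject `Fin (suc n)` into `Fin n`.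
injective⇒surjective : ∀ {n} (f : Fin n → Fin n) → (∀ {x y} → f x ≡ f y → x ≡ y) →
                       ∀ y → ∃ λ x → f x ≡ y
injective⇒surjective {suc n} f inj y with any? (λ x → f x ≟ y)
... | yes hit = hit
... | no miss = contradiction (injective⇒≤ {f = λ x → punchOut (avoids x)}
                                 (inj ∘ punchOut-injective (avoids _) (avoids _)))
                              ℕ.1+n≰n
  where
  avoids : ∀ x → y ≢ f x
  avoids x y≡fx = miss (x , sym y≡fx)

module _ {n : ℕ} {_⊏_ : Rel (Fin n) 0ℓ} (isSTO : IsStrictTotalOrder _≡_ _⊏_) where
  private module O = IsStrictTotalOrder isSTO

  private
    below : Fin n → Subset n
    below x = subset (λ y → y O.<? x)

    below-mono : ∀ {x y} → x ⊏ y → ∣ below x ∣ ℕ.< ∣ below y ∣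
    below-mono {x} {y} x⊏y = p⊂q⇒∣p∣<∣q∣
      (subset-⊂ (O._<? x) (O._<? y) (λ z⊏x → O.trans z⊏x x⊏y) x⊏y (O.irrefl refl))

    below-bound : ∀ x → ∣ below x ∣ ℕ.< n
    below-bound x = subst (∣ below x ∣ ℕ.<_) (∣⊤∣≡n n)
      (p⊂q⇒∣p∣<∣q∣ ((λ _ → ∈⊤) , x , ∈⊤ , O.irrefl refl ∘ ∈-subset⁻ (O._<? x)))

    rank : Fin n → Fin n
    rank x = fromℕ< (below-bound x)

    rank-mono : ∀ {x y} → x ⊏ y → rank x < rank y
    rank-mono x⊏y = subst₂ ℕ._<_ (sym (toℕ-fromℕ< _)) (sym (toℕ-fromℕ< _)) (below-mono x⊏y)

    rank-injective : ∀ {x y} → rank x ≡ rank y → x ≡ y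
    rank-injective {x} {y} eq with O.compare x y
    ... | tri< x⊏y _ _ = contradiction (rank-mono x⊏y) (ℕ.<-irrefl (cong toℕ eq))
    ... | tri≈ _ x≡y _ = x≡y
    ... | tri> _ _ y⊏x = contradiction (rank-mono y⊏x) (ℕ.<-irrefl (cong toℕ (sym eq)))

    unrank : ∀ k → ∃ λ x → rank x ≡ k
    unrank = injective⇒surjective rank rank-injective

  -- The position of an element is the number of its predecessors; this rank is strictly monotone,
  -- hence injective, hence bijective.
  linearise : ∃ λ (π : Permutation′ n) → ∀ {x y} → x ⊏ y ⇔ (π ⟨$⟩ˡ x) < (π ⟨$⟩ˡ y)
  linearise =
    permutation (proj₁ ∘ unrank) rank
      (λ x → rank-injective (proj₂ (unrank (rank x)))) (proj₂ ∘ unrank) ,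
    mk⇔ rank-mono reflect
    where
    reflect : ∀ {x y} → rank x < rank y → x ⊏ y
    reflect {x} {y} lt with O.compare x y
    ... | tri< x⊏y _ _  = x⊏y
    ... | tri≈ _ refl _ = contradiction lt (ℕ.<-irrefl refl)
    ... | tri> _ _ y⊏x  = contradiction (rank-mono y⊏x) (ℕ.<-asym lt)

-- Adjacent positions and their transposition.

adjacent⇒monotone : ∀ {n} {A : Set} {_⊏_ : Rel A 0ℓ} → Binary.Transitive _⊏_ → (f : Fin n → A) →
  (∀ p q → toℕ q ≡ suc (toℕ p) → f p ⊏ f q) → ∀ {k l} → k < l → f k ⊏ f l
adjacent⇒monotone {_⊏_ = _⊏_} tr f adj {zero}  {suc zero}    _ = adj zero (suc zero) refl
adjacent⇒monotone {_⊏_ = _⊏_} tr f adj {zero}  {suc (suc l)} _ =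
  tr (adj zero (suc zero) refl)
     (adjacent⇒monotone {_⊏_ = _⊏_} tr (f ∘ suc) (λ p q e → adj (suc p) (suc q) (cong suc e)) {zero} {suc l} z<s)
adjacent⇒monotone {_⊏_ = _⊏_} tr f adj {suc k} {suc l} (s<s k<l) =
  adjacent⇒monotone {_⊏_ = _⊏_} tr (f ∘ suc) (λ p q e → adj (suc p) (suc q) (cong suc e)) k<l

module _ {n : ℕ} {p q : Fin n} (q≡1+p : toℕ q ≡ suc (toℕ p)) where

  private
    p<q : p < q
    p<q = ℕ.≤-reflexive (sym q≡1+p)

    <q⇒≤p : ∀ {a : Fin n} → a < q → a ≤ p
    <q⇒≤p {a} a<q = ℕ.s≤s⁻¹ (subst (suc (toℕ a) ℕ.≤_) q≡1+p a<q)

    p<⇒q≤ : ∀ {a : Fin n} → p < a → q ≤ a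
    p<⇒q≤ {a} p<a = subst (ℕ._≤ toℕ a) (sym q≡1+p) p<a

  -- No position lies strictly between `p` and `q`, so any third position compares in the same way
  -- with both.
  swap-mono : ∀ {a b} → a < b → ¬ (a ≡ p × b ≡ q) → swap q p a < swap q p b
  swap-mono {a} {b} a<b ¬pq with a ≟ q | b ≟ q
  ... | yes refl | yes refl = contradiction a<b (ℕ.<-irrefl {toℕ q} refl)
  ... | yes refl | no _ with b ≟ p
  ...   | yes refl = contradiction a<b (ℕ.<-asym {toℕ p} p<q)
  ...   | no _     = ℕ.<-trans p<q a<b
  swap-mono {a} {b} a<b ¬pq | no _ | yes refl with a ≟ p
  ...   | yes refl = contradiction (refl , refl) ¬pq
  ...   | no a≢p   = ≤∧≢⇒< (<q⇒≤p {a} a<b) a≢p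
  swap-mono {a} {b} a<b ¬pq | no _ | no b≢q with a ≟ p | b ≟ p
  ...   | yes refl | yes refl = contradiction a<b (ℕ.<-irrefl {toℕ p} refl)
  ...   | yes refl | no _     = ≤∧≢⇒< (p<⇒q≤ {b} a<b) (b≢q ∘ sym)
  ...   | no _     | yes refl = ℕ.<-trans a<b p<q
  ...   | no _     | no _     = a<b

  swap-pq : swap q p q < swap q p p
  swap-pq with q ≟ q | p ≟ q
  ... | no q≢q | _        = contradiction refl q≢q
  ... | yes _  | yes refl = contradiction p<q (ℕ.<-irrefl refl)
  ... | yes _  | no _ with p ≟ p
  ...   | yes _  = p<q
  ...   | no p≢p = contradiction refl p≢p

-- Inversion sets.

module _ {n : ℕ} where

  pos-injective : (π : Permutation′ n) → ∀ {x y} → π ⟨$⟩ˡ x ≡ π ⟨$⟩ˡ y → x ≡ y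
  pos-injective π eq = trans (sym (inverseʳ π)) (trans (cong (π ⟨$⟩ʳ_) eq) (inverseʳ π))

  inversion? : (π : Permutation′ n) → ∀ i j → Dec (Inversion π i j)
  inversion? π i j = (i <? j) ×-dec ((π ⟨$⟩ˡ j) <? (π ⟨$⟩ˡ i))

  private
    Inv : Permutation′ n → Pred (Fin (n * n)) 0ℓ
    Inv π c = Inversion π (proj₁ (remQuot {n} n c)) (proj₂ (remQuot {n} n c))

    inv? : ∀ π → Decidable (Inv π)
    inv? π c = inversion? π (proj₁ (remQuot {n} n c)) (proj₂ (remQuot {n} n c))

  -- Pairs are coded in `Fin (n * n)` to make inversion sets a `Subset`, whose well-founded growth
  -- bounds the sorting of one permutation into another.
  inversions : Permutation′ n → Subset (n * n)
  inversions π = subset (inv? π)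

  inversions-⊂ : ∀ {π ρ} → π ≤ʷ ρ → ∀ {i j} → Inversion ρ i j → ¬ Inversion π i j →
                 inversions π ⊂ inversions ρ
  inversions-⊂ {π} {ρ} π≤ρ {i} {j} inρ ¬inπ = subset-⊂ (inv? π) (inv? ρ) (π≤ρ _ _) {combine i j}
    (subst (λ (u , v) → Inversion ρ u v) (sym (remQuot-combine i j)) inρ)
    (¬inπ ∘ subst (λ (u , v) → Inversion π u v) (remQuot-combine {n} {n} i j))

  ≰⇒pos< : (π : Permutation′ n) → ∀ {x y} → x ≢ y → ¬ (π ⟨$⟩ˡ x) < (π ⟨$⟩ˡ y) → (π ⟨$⟩ˡ y) < (π ⟨$⟩ˡ x)
  ≰⇒pos< π {x} {y} x≢y ¬lt with <-cmp (π ⟨$⟩ˡ x) (π ⟨$⟩ˡ y)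
  ... | tri< lt _ _ = contradiction lt ¬lt
  ... | tri≈ _ eq _ = contradiction (pos-injective π eq) x≢y
  ... | tri> _ _ gt = gt

-- Orientations, linear extensions and acyclicity.

module _ {n : ℕ} (𝓘 : IntervalHypergraph n) where
  open IntervalHypergraph 𝓘

  anyHyperedge? : {P : Pred (Hyperedge 𝓘) 0ℓ} → Decidable P → Dec (∃ P)
  anyHyperedge? {P} P? =
    map′ (λ (S , e , p) → (S , e) , p) (λ ((S , e) , p) → S , e , p) (anySubset? above?)
    where
    above? : ∀ S → Dec (∃ λ e → P (S , e))
    above? S with T? (isEdge S)
    ... | no ¬e = no (¬e ∘ proj₁)
    ... | yes e = map′ (e ,_) (λ (e′ , p) → subst (λ e → P (S , e)) (T-irrelevant e′ e) p) (P? (S , e))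

  _≈ᴼ?_ : Binary.Decidable (_≈ᴼ_ 𝓘)
  O ≈ᴼ? O′ with anyHyperedge? (λ H → ¬? (Orientation.head O H ≟ Orientation.head O′ H))
  ... | yes (H , ≢) = no (λ eq → ≢ (eq H))
  ... | no ¬∃       = yes (λ H → decidable-stable (_ ≟ _) (λ ≢ → ¬∃ (H , ≢)))

  -- Required only on the generators of `Precedes`; `linear⇒precedes` passes to the closure. The
  -- fibre of `O` consists of exactly these `π`.
  LinearExtension : Orientation 𝓘 → Permutation′ n → Set
  LinearExtension O π = ∀ H {x} → NonHead 𝓘 O x H → (π ⟨$⟩ˡ Orientation.head O H) < (π ⟨$⟩ˡ x)

  Or-first : ∀ π H {x} → x ∈ proj₁ H → (π ⟨$⟩ˡ Orientation.head (Or 𝓘 π) H) ≤ (π ⟨$⟩ˡ x)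
  Or-first π H {x} x∈H = subst (_≤ (π ⟨$⟩ˡ x)) (sym (inverseˡ π)) (ℕ.≮⇒≥ λ lt →
    proj₂ (proj₂ (firstIn 𝓘 π H)) lt (subst (_∈ proj₁ H) (sym (inverseʳ π)) x∈H))

  Or-first-< : ∀ π H {x} → x ∈ proj₁ H → x ≢ Orientation.head (Or 𝓘 π) H →
               (π ⟨$⟩ˡ Orientation.head (Or 𝓘 π) H) < (π ⟨$⟩ˡ x)
  Or-first-< π H x∈H x≢ =
    ℕ.≤∧≢⇒< (Or-first π H x∈H) (x≢ ∘ sym ∘ pos-injective π ∘ toℕ-injective)

  Or≈⇒linear : ∀ {π O} → _≈ᴼ_ 𝓘 (Or 𝓘 π) O → LinearExtension O π
  Or≈⇒linear {π} eq H {x} (x∈H , x≢) =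
    subst (λ h → (π ⟨$⟩ˡ h) < (π ⟨$⟩ˡ x)) (eq H) (Or-first-< π H x∈H (λ x≡ → x≢ (trans x≡ (eq H))))

  linear⇒Or≈ : ∀ {π O} → LinearExtension O π → _≈ᴼ_ 𝓘 (Or 𝓘 π) O
  linear⇒Or≈ {π} {O} lin H = decidable-stable (_ ≟ _) λ ≢ →
    ℕ.<⇒≱ (lin H (Orientation.head∈ (Or 𝓘 π) H , ≢)) (Or-first π H (Orientation.head∈ O H))

  -- Positions of successive heads increase along a cycle, while its closing edge puts the last head
  -- before the first.
  linear⇒acyclic : ∀ {O π} → LinearExtension O π → Acyclic 𝓘 O
  linear⇒acyclic {O} {π} lin (m , H , steps , last) = ℕ.<-asym (lin _ last)
    (adjacent⇒monotone {_⊏_ = _<_} ℕ.<-trans (λ k → π ⟨$⟩ˡ Orientation.head O (H k)) increasing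
       {zero} {fromℕ (suc m)} z<s)
    where
    increasing : ∀ p q → toℕ q ≡ suc (toℕ p) →
                 (π ⟨$⟩ˡ Orientation.head O (H p)) < (π ⟨$⟩ˡ Orientation.head O (H q))
    increasing p (suc i) eq
      with refl ← toℕ-injective {i = p} {j = inject₁ i} (trans (ℕ.suc-injective (sym eq)) (sym (toℕ-inject₁ i)))
      = lin _ (steps i)

  Or-acyclic : ∀ π → Acyclic 𝓘 (Or 𝓘 π)
  Or-acyclic π = linear⇒acyclic {Or 𝓘 π} {π} (Or≈⇒linear {π} {Or 𝓘 π} (λ _ → refl))

  linear⇒precedes : ∀ {O π} → LinearExtension O π → ∀ {x y} → Precedes 𝓘 O x y → (π ⟨$⟩ˡ x) < (π ⟨$⟩ˡ y)
  linear⇒precedes lin [ H , refl , nh ]     = lin H nh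
  linear⇒precedes {O} {π} lin ((H , refl , nh) ∷ p) =
    ℕ.<-trans (lin H nh) (linear⇒precedes {O} {π} lin p)

  -- Brings a chain into the indexed form of `Cycle`, so that a chain from `x` to itself can be read
  -- as a cycle.
  precedes⇒path : ∀ {O x y} → Precedes 𝓘 O x y → ∃ λ k → Σ (Fin (suc k) → Hyperedge 𝓘) λ H →
    Orientation.head O (H zero) ≡ x ×
    (∀ (i : Fin k) → NonHead 𝓘 O (Orientation.head O (H (suc i))) (H (inject₁ i))) ×
    NonHead 𝓘 O y (H (fromℕ k))
  precedes⇒path [ I , eq , nh ] = 0 , (λ _ → I) , eq , (λ ()) , nh
  precedes⇒path {O} ((I , eq , nh) ∷ p) with k , H , refl , steps , last ← precedes⇒path {O} p =
    suc k , (I ◂ H) , eq , (λ { zero → nh ; (suc i) → steps i }) , last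

  acyclic⇒irrefl : ∀ O → Acyclic 𝓘 O → ∀ {x} → ¬ Precedes 𝓘 O x x
  acyclic⇒irrefl O ac p with precedes⇒path {O} p
  -- A single hyperedge is too short for `Cycle`, but its head is not among its own non-heads.
  ... | zero  , H , refl , steps , (_ , ≢) = ≢ refl
  ... | suc m , H , refl , steps , last    = ac (m , H , steps , last)

  -- Betweenness and the order `≺`.

  -- Symmetric in the outer arguments, so that one argument serves the natural order and its
  -- reverse.
  Between : Fin n → Fin n → Fin n → Set
  Between x y z = (x ≤ y × y ≤ z) ⊎ (z ≤ y × y ≤ x)

  between-split : ∀ {x y z} → Between x y z → ∀ h → Between x y h ⊎ Between h y z
  between-split {y = y} (inj₁ (x≤y , y≤z)) h with ≤-total y h
  ... | inj₁ y≤h = inj₁ (inj₁ (x≤y , y≤h))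
  ... | inj₂ h≤y = inj₂ (inj₁ (h≤y , y≤z))
  between-split {y = y} (inj₂ (z≤y , y≤x)) h with ≤-total y h
  ... | inj₁ y≤h = inj₂ (inj₂ (z≤y , y≤h))
  ... | inj₂ h≤y = inj₁ (inj₂ (h≤y , y≤x))

  hyperedge-convex : ∀ (H : Hyperedge 𝓘) {x y z} → x ∈ proj₁ H → z ∈ proj₁ H → Between x y z → y ∈ proj₁ H
  hyperedge-convex (S , e) {x} {y} {z} x∈ z∈ btw with a , b , _ , mem ← intervals S e =
    Equivalence.from (mem y) (bounds btw)
    where
    bounds : Between x y z → a ≤ y × y ≤ b
    bounds (inj₁ (x≤y , y≤z)) =
      ℕ.≤-trans (proj₁ (Equivalence.to (mem x) x∈)) x≤y , ℕ.≤-trans y≤z (proj₂ (Equivalence.to (mem z) z∈))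
    bounds (inj₂ (z≤y , y≤x)) =
      ℕ.≤-trans (proj₁ (Equivalence.to (mem z) z∈)) z≤y , ℕ.≤-trans y≤x (proj₂ (Equivalence.to (mem x) x∈))

  module _ (O : Orientation 𝓘) where
    open Orientation O

    precedes? : Binary.Decidable (Precedes 𝓘 O)
    precedes? = transClosure? λ x h → anyHyperedge? λ I →
      (head I ≟ x) ×-dec ((h ∈? proj₁ I) ×-dec ¬? (h ≟ head I))

    -- Either the first step of the chain spans `y`, and convexity puts `y` in its hyperedge, or `y`
    -- lies between the next vertex and `z`, and the rest of the chain takes over.
    precedes-between : ∀ {x y z} → Precedes 𝓘 O x z → Between x y z → y ≢ x → Precedes 𝓘 O x y
    precedes-between [ I , refl , (z∈I , _) ] btw y≢x =
      [ I , refl , hyperedge-convex I (head∈ I) z∈I btw , y≢x ]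
    precedes-between {x} {y} (_∷_ {y = h} (I , refl , (h∈I , h≢)) p) btw y≢x with between-split btw h
    ... | inj₁ btw₁ = [ I , refl , hyperedge-convex I (head∈ I) h∈I btw₁ , y≢x ]
    ... | inj₂ btw₂ with y ≟ h
    ...   | yes refl = [ I , refl , h∈I , h≢ ]
    ...   | no y≢h   = (I , refl , h∈I , h≢) ∷ precedes-between p btw₂ y≢h

  between-sym : ∀ {x y z} → Between x y z → Between z y x
  between-sym (inj₁ b) = inj₂ b
  between-sym (inj₂ b) = inj₁ b

  -- Linear extensions of `≺` guided by a base order.

  module _ (O : Orientation 𝓘) (ac : Acyclic 𝓘 O) {_◁_ : Rel (Fin n) 0ℓ}
           (isSTO : IsStrictTotalOrder _≡_ _◁_)
           (◁-between : ∀ {x y z} → x ◁ y → y ◁ z → Between x y z) where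
    private
      module O = IsStrictTotalOrder isSTO

      _≺_ : Rel (Fin n) 0ℓ
      _≺_ = Precedes 𝓘 O

      ◁⇒≢ : ∀ {x y} → x ◁ y → x ≢ y
      ◁⇒≢ x◁y refl = O.irrefl refl x◁y

    -- The base order, overridden wherever `≺` forces the opposite. The natural order will give the
    -- least permutation of the fibre, its reverse the greatest.
    Extended : Rel (Fin n) 0ℓ
    Extended x y = x ≺ y ⊎ (x ◁ y × ¬ (y ≺ x))

    extended-irrefl : ∀ {x} → ¬ Extended x x
    extended-irrefl (inj₁ x≺x)       = acyclic⇒irrefl O ac x≺x
    extended-irrefl (inj₂ (x◁x , _)) = O.irrefl refl x◁x

    -- Where concatenation does not decide, a relation `≺` joins the two `◁`-extremes of `x`, `y`,
    -- `z`, and `precedes-between` carries it to the middle one.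
    extended-trans : Binary.Transitive Extended
    extended-trans (inj₁ x≺y) (inj₁ y≺z) = inj₁ (x≺y ++ y≺z)
    extended-trans {x} {y} {z} (inj₁ x≺y) (inj₂ (y◁z , z⊀y)) with O.compare x z
    ... | tri< x◁z _ _  = inj₂ (x◁z , λ z≺x → z⊀y (z≺x ++ x≺y))
    ... | tri≈ _ refl _ = contradiction x≺y z⊀y
    ... | tri> _ _ z◁x  = inj₁ (precedes-between O x≺y (between-sym (◁-between y◁z z◁x)) (◁⇒≢ z◁x))
    extended-trans {x} {y} {z} (inj₂ (x◁y , y⊀x)) (inj₁ y≺z) with O.compare x z
    ... | tri< x◁z _ _  = inj₂ (x◁z , λ z≺x → y⊀x (y≺z ++ z≺x))
    ... | tri≈ _ refl _ = contradiction y≺z y⊀x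
    ... | tri> _ _ z◁x  =
      contradiction (precedes-between O y≺z (between-sym (◁-between z◁x x◁y)) (◁⇒≢ x◁y)) y⊀x
    extended-trans (inj₂ (x◁y , y⊀x)) (inj₂ (y◁z , z⊀y)) =
      inj₂ (O.trans x◁y y◁z , λ z≺x → z⊀y (precedes-between O z≺x (between-sym (◁-between x◁y y◁z)) (◁⇒≢ y◁z)))

    extended-total : ∀ {x y} → x ≢ y → Extended x y ⊎ Extended y x
    extended-total {x} {y} x≢y with O.compare x y
    ... | tri≈ _ x≡y _ = contradiction x≡y x≢y
    ... | tri< x◁y _ _ with precedes? O y x
    ...   | yes y≺x = inj₂ (inj₁ y≺x)
    ...   | no y⊀x  = inj₁ (inj₂ (x◁y , y⊀x))
    extended-total {x} {y} x≢y | tri> _ _ y◁x with precedes? O x y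
    ...   | yes x≺y = inj₁ (inj₁ x≺y)
    ...   | no x⊀y  = inj₂ (inj₂ (y◁x , x⊀y))

    extended-isStrictTotalOrder : IsStrictTotalOrder _≡_ Extended
    extended-isStrictTotalOrder = record
      { isStrictPartialOrder = record
        { isEquivalence = isEquivalence
        ; irrefl = λ { refl → extended-irrefl }
        ; trans = extended-trans
        ; <-resp-≈ = (λ { refl e → e }) , (λ { refl e → e })
        }
      ; compare = compare
      }
      where
      asym : ∀ {x y} → Extended x y → ¬ Extended y x
      asym p q = extended-irrefl (extended-trans p q)
      compare : Binary.Trichotomous _≡_ Extended
      compare x y with x ≟ y
      ... | yes refl = tri≈ extended-irrefl refl extended-irrefl
      ... | no x≢y with extended-total x≢y
      ...   | inj₁ p = tri< p x≢y (asym p)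
      ...   | inj₂ p = tri> (asym p) x≢y p

    extension : ∃ λ (π : Permutation′ n) → ∀ {x y} → Extended x y ⇔ (π ⟨$⟩ˡ x) < (π ⟨$⟩ˡ y)
    extension = linearise extended-isStrictTotalOrder

  -- Fibres as intervals of the weak order.

  module _ (O : Orientation 𝓘) (ac : Acyclic 𝓘 O) where

    -- For `i < j` the base order never puts `j` first, so an inversion can only come from `j ≺ i`.
    minExtension : ∃ λ σ → ∀ {i j} → Inversion σ i j ⇔ (i < j × Precedes 𝓘 O j i)
    minExtension with σ , spec ← extension O ac <-isStrictTotalOrder
                                   (λ x<y y<z → inj₁ (ℕ.<⇒≤ x<y , ℕ.<⇒≤ y<z)) =
      σ , mk⇔ (λ (i<j , lt) → i<j , strip i<j (Equivalence.from spec lt))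
              (λ (i<j , j≺i) → i<j , Equivalence.to spec (inj₁ j≺i))
      where
      strip : ∀ {i j} → i < j → Precedes 𝓘 O j i ⊎ (j < i × ¬ Precedes 𝓘 O i j) → Precedes 𝓘 O j i
      strip i<j (inj₁ j≺i)       = j≺i
      strip i<j (inj₂ (j<i , _)) = contradiction j<i (ℕ.<-asym i<j)

    -- The reversed base order puts `j` first unless `i ≺ j` forbids it; acyclicity keeps `j ≺ i`
    -- and `i ≺ j` apart.
    maxExtension : ∃ λ τ → ∀ {i j} → Inversion τ i j ⇔ (i < j × ¬ Precedes 𝓘 O i j)
    maxExtension with τ , spec ← extension O ac (Flip.isStrictTotalOrder <-isStrictTotalOrder)
                                   (λ y<x z<y → inj₂ (ℕ.<⇒≤ z<y , ℕ.<⇒≤ y<x)) =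
      τ , mk⇔ (λ (i<j , lt) → i<j , strip (Equivalence.from spec lt))
              (λ (i<j , i⊀j) → i<j , Equivalence.to spec (inj₂ (i<j , i⊀j)))
      where
      strip : ∀ {i j} → Precedes 𝓘 O j i ⊎ (i < j × ¬ Precedes 𝓘 O i j) → ¬ Precedes 𝓘 O i j
      strip (inj₁ j≺i) i≺j       = acyclic⇒irrefl O ac (i≺j ++ j≺i)
      strip (inj₂ (_ , i⊀j)) i≺j = i⊀j i≺j

    -- Lying above `σ` means respecting the relations of `≺` that descend, lying below `τ` those
    -- that ascend; together they say that `π` is a linear extension.
    extremal⇒fibre : ∀ {σ τ} → (∀ {i j} → Inversion σ i j ⇔ (i < j × Precedes 𝓘 O j i)) →
                     (∀ {i j} → Inversion τ i j ⇔ (i < j × ¬ Precedes 𝓘 O i j)) → FibreIs[_,_] 𝓘 σ τ O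
    extremal⇒fibre {σ} {τ} σ-inv τ-inv = σ≤τ , λ π → mk⇔ (to π) (from π)
      where
      σ≤τ : σ ≤ʷ τ
      σ≤τ i j inv with i<j , j≺i ← Equivalence.to σ-inv inv =
        Equivalence.from τ-inv (i<j , λ i≺j → acyclic⇒irrefl O ac (i≺j ++ j≺i))

      to : ∀ π → _≈ᴼ_ 𝓘 (Or 𝓘 π) O → σ ≤ʷ π × π ≤ʷ τ
      to π eq =
        (λ i j inv → let (i<j , j≺i) = Equivalence.to σ-inv inv in i<j , precedes⇒pos j≺i) ,
        (λ i j (i<j , lt) → Equivalence.from τ-inv (i<j , λ i≺j → ℕ.<-asym lt (precedes⇒pos i≺j)))
        where
        precedes⇒pos : ∀ {x y} → Precedes 𝓘 O x y → (π ⟨$⟩ˡ x) < (π ⟨$⟩ˡ y)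
        precedes⇒pos = linear⇒precedes {O} {π} (Or≈⇒linear {π} {O} eq)

      from : ∀ π → σ ≤ʷ π × π ≤ʷ τ → _≈ᴼ_ 𝓘 (Or 𝓘 π) O
      from π (σ≤π , π≤τ) = linear⇒Or≈ {π} {O} lin
        where
        lin : LinearExtension O π
        lin H {x} nh@(_ , x≢h) with <-cmp (Orientation.head O H) x
        ... | tri≈ _ h≡x _ = contradiction (sym h≡x) x≢h
        ... | tri> _ _ x<h = proj₂ (σ≤π _ _ (Equivalence.from σ-inv (x<h , [ H , refl , nh ])))
        ... | tri< h<x _ _ = ≰⇒pos< π x≢h λ lt →
          proj₂ (Equivalence.to τ-inv (π≤τ _ _ (h<x , lt))) [ H , refl , nh ]

  -- Reversals, comparison of heads and the weak order.

  module _ (A B : Orientation 𝓘) (acA : Acyclic 𝓘 A) (acB : Acyclic 𝓘 B) where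
    private
      module A = Orientation A
      module B = Orientation B

    NoReversal : Set
    NoReversal = ∀ i j → i < j → Precedes 𝓘 A j i → ¬ Precedes 𝓘 B i j

    -- A hyperedge whose head drops from `A` to `B` is itself a one-step reversal.
    noReversal⇒heads≤ : NoReversal → ∀ H → A.head H ≤ B.head H
    noReversal⇒heads≤ d H = ℕ.≮⇒≥ λ B<A →
      d _ _ B<A
        [ H , refl , B.head∈ H , ℕ.<⇒≢ B<A ∘ cong toℕ ]
        [ H , refl , A.head∈ H , ℕ.<⇒≢ B<A ∘ cong toℕ ∘ sym ]

    -- The ends of a fibre belong to it, so `σA` and `τB` are linear extensions: `j ≺ i` in `A`
    -- makes an inversion of `σA`, and `i ≺ j` in `B` forbids it in `τB`.
    weak⇒noReversal : σ[_]≤τ[_] 𝓘 A B → NoReversal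
    weak⇒noReversal (σA , τA , σB , τB , fibA , fibB , σ≤τ) i j i<j j≺i i≺j =
      ℕ.<-asym (proj₂ (σ≤τ i j (i<j , pos A σA σA∈ j≺i))) (pos B τB τB∈ i≺j)
      where
      σA∈ : _≈ᴼ_ 𝓘 (Or 𝓘 σA) A
      σA∈ = Equivalence.from (proj₂ fibA σA) ((λ _ _ inv → inv) , proj₁ fibA)
      τB∈ : _≈ᴼ_ 𝓘 (Or 𝓘 τB) B
      τB∈ = Equivalence.from (proj₂ fibB τB) (proj₁ fibB , (λ _ _ inv → inv))
      pos : ∀ O π → _≈ᴼ_ 𝓘 (Or 𝓘 π) O → ∀ {x y} → Precedes 𝓘 O x y → (π ⟨$⟩ˡ x) < (π ⟨$⟩ˡ y)
      pos O π eq = linear⇒precedes {O} {π} (Or≈⇒linear {π} {O} eq)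

    noReversal⇒weak : NoReversal → σ[_]≤τ[_] 𝓘 A B
    noReversal⇒weak d
      with σA , σA-inv ← minExtension A acA | τA , τA-inv ← maxExtension A acA
         | σB , σB-inv ← minExtension B acB | τB , τB-inv ← maxExtension B acB =
      σA , τA , σB , τB ,
      extremal⇒fibre A acA {σA} {τA} σA-inv τA-inv , extremal⇒fibre B acB {σB} {τB} σB-inv τB-inv ,
      λ i j inv → let (i<j , j≺i) = Equivalence.to σA-inv inv in
        Equivalence.from τB-inv (i<j , d i j i<j j≺i)

    -- Looks at the first step of the chain. Going above `j` would close a cycle by
    -- `precedes-between`; going below `i` puts `i` in the hyperedge, and `x = i` serves.
    descending-step : ∀ {i j} → i < j → Precedes 𝓘 A j i →
      ∃₂ λ I x → A.head I ≡ j × x ∈ proj₁ I × i ≤ x × x < j × (x ≡ i ⊎ Precedes 𝓘 A x i)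
    descending-step {i} {j} i<j [ I , eq , (i∈I , _) ] = I , i , eq , i∈I , ≤-refl , i<j , inj₁ refl
    descending-step {i} {j} i<j (_∷_ {y = x} (I , refl , (x∈I , x≢j)) x≺i) with <-cmp x j
    ... | tri≈ _ x≡j _ = contradiction x≡j x≢j
    ... | tri> _ _ j<x = contradiction
      ((I , refl , (x∈I , x≢j)) ∷ precedes-between A x≺i (inj₂ (ℕ.<⇒≤ i<j , ℕ.<⇒≤ j<x)) (x≢j ∘ sym))
      (acyclic⇒irrefl A acA)
    ... | tri< x<j _ _ with ≤-total i x
    ...   | inj₁ i≤x = I , x , refl , x∈I , i≤x , x<j , inj₂ x≺i
    ...   | inj₂ x≤i = I , i , refl , hyperedge-convex I x∈I (A.head∈ I) (inj₁ (x≤i , ℕ.<⇒≤ i<j)) , ≤-refl , i<j , inj₁ refl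

    -- Selects the first step that reaches or jumps over `j`; its hyperedge contains `j` by
    -- convexity.
    crossing-step : ∀ {w j} → w < j → Precedes 𝓘 B w j →
      ∃ λ J → j ∈ proj₁ J × B.head J < j × (B.head J ≡ w ⊎ Precedes 𝓘 B w (B.head J))
    crossing-step w<j [ J , refl , (j∈J , _) ] = J , j∈J , w<j , inj₁ refl
    crossing-step {w} {j} w<j (_∷_ {y = h} s@(J , refl , (h∈J , _)) h≺j) with h <? j
    ... | no h≮j  = J , hyperedge-convex J (B.head∈ J) h∈J (inj₁ (ℕ.<⇒≤ w<j , ℕ.≮⇒≥ h≮j)) , w<j , inj₁ refl
    ... | yes h<j with crossing-step h<j h≺j
    ...   | J′ , j∈J′ , y<j , inj₁ refl = J′ , j∈J′ , y<j , inj₂ [ s ]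
    ...   | J′ , j∈J′ , y<j , inj₂ h≺y  = J′ , j∈J′ , y<j , inj₂ (s ∷ h≺y)

    -- If the head of the crossing hyperedge were below `i`, convexity would put `i` in that
    -- hyperedge and close a cycle.
    ascending-step : ∀ {i j} → i < j → Precedes 𝓘 B i j →
      ∃ λ J → j ∈ proj₁ J × i ≤ B.head J × B.head J < j
    ascending-step {i} i<j i≺j with crossing-step i<j i≺j
    ... | J , j∈J , y<j , inj₁ refl = J , j∈J , ≤-refl , y<j
    ... | J , j∈J , y<j , inj₂ i≺y  = J , j∈J , ℕ.≮⇒≥ no-drop , y<j
      where
      no-drop : ¬ (B.head J < i)
      no-drop y<i = acyclic⇒irrefl B acB (i≺y ∷ʳ (J , refl ,
        hyperedge-convex J (B.head∈ J) j∈J (inj₁ (ℕ.<⇒≤ y<i , ℕ.<⇒≤ i<j)) , ℕ.<⇒≢ y<i ∘ cong toℕ ∘ sym))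

    -- Two different heads would precede each other, one through `I` and the other through `K`.
    head-of-smaller : ∀ O → Acyclic 𝓘 O → ∀ {I K : Hyperedge 𝓘} → (∀ {x} → x ∈ proj₁ K → x ∈ proj₁ I) →
                      Orientation.head O I ∈ proj₁ K → Orientation.head O K ≡ Orientation.head O I
    head-of-smaller O acO {I} {K} K⊆I h∈K = decidable-stable (_ ≟ _) λ ≢ → acyclic⇒irrefl O acO
      ((I , refl , K⊆I (Orientation.head∈ O K) , ≢) ∷ [ K , refl , h∈K , ≢ ∘ sym ])

    -- For a step I of A descending from j and a step J of B ascending to j, the
    -- hyperedge I ∩ J contains j. If it also contains the head of J then A and B
    -- disagree with (b) there; otherwise the reversal shrinks to (i , x).
    heads≤⇒noReversal : ClosedUnderIntersection 𝓘 → (∀ H → A.head H ≤ B.head H) → NoReversal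
    heads≤⇒noReversal closed b i j = go j (<-wellFounded j)
      where
      go : ∀ j → Acc _<_ j → i < j → Precedes 𝓘 A j i → ¬ Precedes 𝓘 B i j
      go j (acc rec) i<j j≺i i≺j
        with I , x , refl , x∈I , i≤x , x<j , x≼i ← descending-step i<j j≺i
           | J , j∈J , i≤y , y<j ← ascending-step i<j i≺j
        with x ≤? B.head J
      ... | yes x≤y = ℕ.<⇒≱ y<j (subst₂ _≤_
              (head-of-smaller A acA {I} {K} (proj₁ ∘ x∈p∩q⁻ _ _) j∈K)
              (head-of-smaller B acB {J} {K} (proj₂ ∘ x∈p∩q⁻ _ _) y∈K)
              (b K))
        where
        j∈K : j ∈ proj₁ I ∩ proj₁ J
        j∈K = x∈p∩q⁺ (A.head∈ I , j∈J)
        K : Hyperedge 𝓘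
        K = proj₁ I ∩ proj₁ J , closed _ _ (proj₂ I) (proj₂ J) (j , j∈K)
        y∈K : B.head J ∈ proj₁ K
        y∈K = x∈p∩q⁺ (hyperedge-convex I x∈I (A.head∈ I) (inj₁ (x≤y , ℕ.<⇒≤ y<j)) , B.head∈ J)
      ... | no x≰y with x≼i
      ...   | inj₁ refl = x≰y i≤y
      -- The lower end stays; `x` lies between `i` and `j`, so `i` precedes it in `B`.
      ...   | inj₂ x≺i  = go x (rec x<j) i<x x≺i
                (precedes-between B i≺j (inj₁ (i≤x , ℕ.<⇒≤ x<j)) (ℕ.<⇒≢ i<x ∘ cong toℕ ∘ sym))
        where
        i<x : i < x
        i<x = ℕ.≤-<-trans i≤y (ℕ.≰⇒> x≰y)

  -- Flips and their effect on heads.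

  -- Leaves out the distinctness in `IncreasingFlip`, so that it also holds for an exchange that
  -- does not change the orientation.
  IsFlip : Fin n → Fin n → Orientation 𝓘 → Orientation 𝓘 → Set
  IsFlip i j O O′ = ∀ H →
    (head O H ≢ head O′ H → head O H ≡ i × head O′ H ≡ j) ×
    (i ∈ proj₁ H → j ∈ proj₁ H → (head O H ≡ i ⇔ head O′ H ≡ j))
    where open Orientation

  isFlip-resp : ∀ {i j O₁ O₂ O₁′ O₂′} → _≈ᴼ_ 𝓘 O₁ O₁′ → _≈ᴼ_ 𝓘 O₂ O₂′ →
                IsFlip i j O₁ O₂ → IsFlip i j O₁′ O₂′
  isFlip-resp eq₁ eq₂ fl H with eq₁ H | eq₂ H
  ... | e₁ | e₂ = subst₂ (λ a b → (a ≢ b → a ≡ _ × b ≡ _) × (_ → _ → (a ≡ _ ⇔ b ≡ _))) e₁ e₂ (fl H)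

  flip-resp : ∀ {O₁ O₂ O₁′ O₂′} → _≈ᴼ_ 𝓘 O₁ O₁′ → _≈ᴼ_ 𝓘 O₂ O₂′ →
              IncreasingFlip 𝓘 O₁ O₂ → IncreasingFlip 𝓘 O₁′ O₂′
  flip-resp {O₁} {O₂} {O₁′} {O₂′} eq₁ eq₂ (≉ , i , j , i<j , fl) =
    (λ eq → ≉ (λ H → trans (eq₁ H) (trans (eq H) (sym (eq₂ H))))) ,
    i , j , i<j , isFlip-resp {O₁ = O₁} {O₂} {O₁′} {O₂′} eq₁ eq₂ fl

  flip⇒heads≤ : ∀ {O O′} → IncreasingFlip 𝓘 O O′ → ∀ H → Orientation.head O H ≤ Orientation.head O′ H
  flip⇒heads≤ {O} {O′} (_ , i , j , i<j , fl) H with Orientation.head O H ≟ Orientation.head O′ H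
  ... | yes eq = ℕ.≤-reflexive (cong toℕ eq)
  ... | no ≢ with ≡i , ≡j ← proj₁ (fl H) ≢ = subst₂ _≤_ (sym ≡i) (sym ≡j) (ℕ.<⇒≤ i<j)

  ≤ᴾ⇒heads≤ : ∀ {A B} → _≤ᴾ_ 𝓘 A B →
              ∀ H → Orientation.head (proj₁ A) H ≤ Orientation.head (proj₁ B) H
  ≤ᴾ⇒heads≤ (inj₁ eq) H = ℕ.≤-reflexive (cong toℕ (eq H))
  ≤ᴾ⇒heads≤ (inj₂ fs) H = along fs
    where
    along : ∀ {A B : AcyclicOrientation 𝓘} →
            TransClosure (λ O O′ → IncreasingFlip 𝓘 (proj₁ O) (proj₁ O′)) A B →
            Orientation.head (proj₁ A) H ≤ Orientation.head (proj₁ B) H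
    along {A} {B} [ f ] = flip⇒heads≤ {proj₁ A} {proj₁ B} f H
    along {A} (_∷_ {y = O} f fs) = ℕ.≤-trans (flip⇒heads≤ {proj₁ A} {proj₁ O} f H) (along fs)

  flip-≤ᴾ : ∀ {A O B} → IncreasingFlip 𝓘 (proj₁ A) (proj₁ O) → _≤ᴾ_ 𝓘 O B → _≤ᴾ_ 𝓘 A B
  flip-≤ᴾ {A} {O} {B} f (inj₁ eq) =
    -- `O` and `B` agree only pointwise, so the flip is redirected to end at `B`.
    inj₂ [ flip-resp {proj₁ A} {proj₁ O} {proj₁ A} {proj₁ B} (λ _ → refl) eq f ]
  flip-≤ᴾ f (inj₂ fs) = inj₂ (f ∷ fs)

  -- Adjacent exchanges and sorting in the weak order.

  module AdjacentExchange (π : Permutation′ n) {p q : Fin n} (q≡1+p : toℕ q ≡ suc (toℕ p))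
                          (i<j : (π ⟨$⟩ʳ p) < (π ⟨$⟩ʳ q)) where
    private
      i j : Fin n
      i = π ⟨$⟩ʳ p
      j = π ⟨$⟩ʳ q

    -- The left factor of `∘ₚ` acts first, so positions are exchanged; the inverse then applies
    -- `swap q p` to positions.
    exchanged : Permutation′ n
    exchanged = transpose p q ∘ₚ π

    private
      ρ : Permutation′ n
      ρ = exchanged

      i-before-j : (π ⟨$⟩ˡ i) < (π ⟨$⟩ˡ j)
      i-before-j = subst₂ _<_ (sym (inverseˡ π)) (sym (inverseˡ π)) (ℕ.≤-reflexive (sym q≡1+p))

      j-before-i : (ρ ⟨$⟩ˡ j) < (ρ ⟨$⟩ˡ i)
      j-before-i = subst₂ _<_ (cong (swap q p) (sym (inverseˡ π))) (cong (swap q p) (sym (inverseˡ π)))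
                              (swap-pq q≡1+p)

      at : ∀ {u k} → π ⟨$⟩ˡ u ≡ k → u ≡ π ⟨$⟩ʳ k
      at eq = trans (sym (inverseʳ π)) (cong (π ⟨$⟩ʳ_) eq)

    order-preserved : ∀ {u v} → (π ⟨$⟩ˡ u) < (π ⟨$⟩ˡ v) → ¬ (u ≡ i × v ≡ j) → (ρ ⟨$⟩ˡ u) < (ρ ⟨$⟩ˡ v)
    order-preserved lt ¬ij = swap-mono q≡1+p lt (λ (u↦p , v↦q) → ¬ij (at u↦p , at v↦q))

    order-reflected : ∀ {u v} → (ρ ⟨$⟩ˡ u) < (ρ ⟨$⟩ˡ v) → ¬ (u ≡ j × v ≡ i) → (π ⟨$⟩ˡ u) < (π ⟨$⟩ˡ v)
    order-reflected {u} {v} lt ¬ji = ≰⇒pos< π v≢u λ v-before-u → ℕ.<-asym lt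
      (order-preserved v-before-u (λ (v≡i , u≡j) → ¬ji (u≡j , v≡i)))
      where
      v≢u : v ≢ u
      v≢u refl = ℕ.<-irrefl refl lt

    inversion-new : Inversion ρ i j
    inversion-new = i<j , j-before-i

    inversion-old : ¬ Inversion π i j
    inversion-old (_ , lt) = ℕ.<-asym lt i-before-j

    ≤ʷ-exchanged : π ≤ʷ ρ
    ≤ʷ-exchanged u v (u<v , lt) = u<v , order-preserved lt λ { (refl , refl) → ℕ.<-asym u<v i<j }

    -- The pair `i`, `j` is the only inversion gained.
    exchanged-≤ʷ : ∀ {τ} → π ≤ʷ τ → Inversion τ i j → ρ ≤ʷ τ
    exchanged-≤ʷ {τ} π≤τ inv u v (u<v , lt) with u ≟ i ×-dec v ≟ j
    ... | yes (refl , refl) = inv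
    ... | no ¬ij = π≤τ u v (u<v , order-reflected lt (λ (v≡j , u≡i) → ¬ij (u≡i , v≡j)))

    -- Different heads of `H` stand in opposite orders in the two words, and `i`, `j` is the only
    -- pair whose order changes.
    exchange-isFlip : IsFlip i j (Or 𝓘 π) (Or 𝓘 ρ)
    exchange-isFlip H = heads-differ , λ i∈H j∈H → mk⇔ (forth i∈H j∈H) (back i∈H j∈H)
      where
      a b : Fin n
      a = Orientation.head (Or 𝓘 π) H
      b = Orientation.head (Or 𝓘 ρ) H

      heads-differ : a ≢ b → a ≡ i × b ≡ j
      heads-differ a≢b = decidable-stable (a ≟ i ×-dec b ≟ j) λ ¬ij → ℕ.<-asym
        (order-preserved (Or-first-< π H (Orientation.head∈ (Or 𝓘 ρ) H) (a≢b ∘ sym)) ¬ij)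
        (Or-first-< ρ H (Orientation.head∈ (Or 𝓘 π) H) a≢b)

      forth : i ∈ proj₁ H → j ∈ proj₁ H → a ≡ i → b ≡ j
      forth i∈H j∈H a≡i with a ≟ b
      ... | no a≢b  = proj₂ (heads-differ a≢b)
      ... | yes a≡b = contradiction j-before-i
        (ℕ.≤⇒≯ (subst (λ h → (ρ ⟨$⟩ˡ h) ≤ (ρ ⟨$⟩ˡ j)) (trans (sym a≡b) a≡i) (Or-first ρ H j∈H)))

      back : i ∈ proj₁ H → j ∈ proj₁ H → b ≡ j → a ≡ i
      back i∈H j∈H b≡j with a ≟ b
      ... | no a≢b  = proj₁ (heads-differ a≢b)
      ... | yes a≡b = contradiction i-before-j
        (ℕ.≤⇒≯ (subst (λ h → (π ⟨$⟩ˡ h) ≤ (π ⟨$⟩ˡ i)) (trans a≡b b≡j) (Or-first π H i∈H)))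

  -- Bubble sort: as long as τ⁻¹π has a descent at adjacent positions, exchanging
  -- them moves π up the weak order while staying below τ.
  module _ {B : AcyclicOrientation 𝓘} {τ : Permutation′ n} (τ∈B : _≈ᴼ_ 𝓘 (Or 𝓘 τ) (proj₁ B)) where

    ≤ʷ⇒≤ᴾ : ∀ {π} → Acc (flip _⊂_) (inversions π) → (A : AcyclicOrientation 𝓘) →
            _≈ᴼ_ 𝓘 (Or 𝓘 π) (proj₁ A) → π ≤ʷ τ → _≤ᴾ_ 𝓘 A B
    ≤ʷ⇒≤ᴾ {π} (acc rec) A π∈A π≤τ
      with any? (λ p → any? (λ q → (toℕ q ℕ.≟ suc (toℕ p)) ×-dec
                                   ((τ ⟨$⟩ˡ (π ⟨$⟩ʳ q)) <? (τ ⟨$⟩ˡ (π ⟨$⟩ʳ p)))))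
    -- Positions in `τ` increase along the word of `π`, so `τ` is a linear extension of `A` as well
    -- and `A` agrees with `B`.
    ... | no no-descent = inj₁ λ H → trans (sym (linear⇒Or≈ {τ} {proj₁ A} τ-linear H)) (τ∈B H)
      where
      ascent : ∀ p q → toℕ q ≡ suc (toℕ p) → (τ ⟨$⟩ˡ (π ⟨$⟩ʳ p)) < (τ ⟨$⟩ˡ (π ⟨$⟩ʳ q))
      ascent p q q≡1+p = ≰⇒pos< τ q≢p (λ lt → no-descent (p , q , q≡1+p , lt))
        where
        q≢p : π ⟨$⟩ʳ q ≢ π ⟨$⟩ʳ p
        q≢p eq = ℕ.1+n≢n (trans (sym q≡1+p)
          (cong toℕ (trans (sym (inverseˡ π)) (trans (cong (π ⟨$⟩ˡ_) eq) (inverseˡ π)))))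

      τ-linear : LinearExtension (proj₁ A) τ
      τ-linear H nh = subst₂ _<_ (cong (τ ⟨$⟩ˡ_) (inverseʳ π)) (cong (τ ⟨$⟩ˡ_) (inverseʳ π))
        (adjacent⇒monotone {_⊏_ = _<_} ℕ.<-trans (λ k → τ ⟨$⟩ˡ (π ⟨$⟩ʳ k)) ascent
          (Or≈⇒linear {π} {proj₁ A} π∈A H nh))
    ... | yes (p , q , q≡1+p , descent) = next (Or 𝓘 exchanged ≈ᴼ? proj₁ A)
      where
      -- Otherwise the two entries form an inversion of `π`, hence of `τ`, against the descent.
      j≮i : ¬ ((π ⟨$⟩ʳ q) < (π ⟨$⟩ʳ p))
      j≮i j<i = ℕ.<-asym descent (proj₂ (π≤τ _ _ (j<i ,
        subst₂ _<_ (sym (inverseˡ π)) (sym (inverseˡ π)) (ℕ.≤-reflexive (sym q≡1+p)))))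

      i<j : (π ⟨$⟩ʳ p) < (π ⟨$⟩ʳ q)
      i<j with <-cmp (π ⟨$⟩ʳ p) (π ⟨$⟩ʳ q)
      ... | tri< i<j _ _ = i<j
      ... | tri≈ _ i≡j _ = contradiction descent (ℕ.<-irrefl (cong (toℕ ∘ (τ ⟨$⟩ˡ_)) (sym i≡j)))
      ... | tri> _ _ j<i = contradiction j<i j≮i

      open AdjacentExchange π q≡1+p i<j

      ascend : (O : AcyclicOrientation 𝓘) → _≈ᴼ_ 𝓘 (Or 𝓘 exchanged) (proj₁ O) → _≤ᴾ_ 𝓘 O B
      ascend O eq = ≤ʷ⇒≤ᴾ {exchanged}
        (rec (inversions-⊂ {n} {π} {exchanged} ≤ʷ-exchanged inversion-new inversion-old)) O eq
        (exchanged-≤ʷ {τ} π≤τ (i<j , descent))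

      next : Dec (_≈ᴼ_ 𝓘 (Or 𝓘 exchanged) (proj₁ A)) → _≤ᴾ_ 𝓘 A B
      -- Flips join distinct orientations, so an exchange inside the fibre of `A` adds no flip to
      -- the chain.
      next (yes eq) = ascend A eq
      next (no ≉)   = flip-≤ᴾ {A} {O} {B}
        ((λ eq → ≉ (sym ∘ eq)) , _ , _ , i<j ,
          isFlip-resp {O₁ = Or 𝓘 π} {Or 𝓘 exchanged} {proj₁ A} {Or 𝓘 exchanged}
            π∈A (λ _ → refl) exchange-isFlip)
        (ascend O (λ _ → refl))
        where
        O : AcyclicOrientation 𝓘
        O = Or 𝓘 exchanged , Or-acyclic exchanged

  weak⇒≤ᴾ : (A B : AcyclicOrientation 𝓘) → σ[_]≤τ[_] 𝓘 (proj₁ A) (proj₁ B) → _≤ᴾ_ 𝓘 A B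
  weak⇒≤ᴾ A B (σA , τA , σB , τB , fibA , fibB , σ≤τ) = ≤ʷ⇒≤ᴾ {B} {τB}
    (Equivalence.from (proj₂ fibB τB) (proj₁ fibB , (λ _ _ inv → inv)))
    {σA} (⊃-wellFounded (inversions σA)) A
    (Equivalence.from (proj₂ fibA σA) ((λ _ _ inv → inv) , proj₁ fibA)) σ≤τ

theorem4p9 : (n : ℕ) (𝓘 : IntervalHypergraph n) → ClosedUnderIntersection 𝓘 →
    (A B : Orientation 𝓘) (acA : Acyclic 𝓘 A) (acB : Acyclic 𝓘 B) →
    let a = _≤ᴾ_ 𝓘 (A , acA) (B , acB)
        b = (∀ (I : Hyperedge 𝓘) → Orientation.head A I ≤ Orientation.head B I)
        c = σ[_]≤τ[_] 𝓘 A B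
        d = (∀ (i j : Fin n) → i < j → Precedes 𝓘 A j i → ¬ Precedes 𝓘 B i j)
    in (a ⇔ b) × (b ⇔ c) × (c ⇔ d)
theorem4p9 n 𝓘 closed A B acA acB =
  -- The cycle of implications is (a) ⇒ (b) ⇒ (d) ⇒ (c) ⇒ (a), with (c) ⇒ (d) ⇒ (b) as shortcuts.
  mk⇔ (≤ᴾ⇒heads≤ 𝓘 {A , acA} {B , acB}) (weak⇒≤ᴾ 𝓘 (A , acA) (B , acB) ∘ d⇒c ∘ b⇒d) ,
  mk⇔ (d⇒c ∘ b⇒d) (noReversal⇒heads≤ 𝓘 A B acA acB ∘ c⇒d) ,
  mk⇔ c⇒d d⇒c
  where
  b⇒d = heads≤⇒noReversal 𝓘 A B acA acB closed
  c⇒d = weak⇒noReversal 𝓘 A B acA acB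
  d⇒c = noReversal⇒weak 𝓘 A B acA acB
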